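{- Let $C$ be a cycle and let $\mathcal{H},\mathcal{K}$ be families of vertex subsets of $C$ such that the cycle intersection system $(C,\mathcal{H},\mathcal{K})$ is strong $axax$-free. Then there is an outerplanar intersection support for $(C,\mathcal{H},\mathcal{K})$.
   Context: The members of $\mathcal{H},\mathcal{K}$ are (induced, not necessarily connected) subgraphs of $C$, identified with their vertex sets. A family $\mathcal{F}$ is $axax$-free if there are no $F,F'\in\mathcal{F}$ and four distinct vertices $a_1,x_1,a_2,x_2$ in this cyclic order on $C$ with $a_1,a_2\in F\setminus F'$ and $x_1,x_2\in F'$. $(C,\mathcal{H},\mathcal{K})$ satisfies the intersection property if for any $H\in\mathcal{H}$, $K\in\mathcal{K}$ and vertices $h_1,k_1,h_2,k_2$ in cyclic order on $C$ with $h_1,h_2\in H$, $k_1,k_2\in K$, we have $H\cap K\ne\emptyset$. It is strong $axax$-free if $\mathcal{H}$ and $\mathcal{K}$ are both $axax$-free and it satisfies the intersection property. An intersection support is a graph on vertex set $\mathcal{H}$ in which $\{H\in\mathcal{H}: H\cap K\ne\emptyset\}$ induces a connected subgraph for every $K\in\mathcal{K}$. Outerplanar: has a planar embedding with all vertices on the outer face. -}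

module Defs where

open import Data.Nat using (ℕ; _<_; _≤_)
open import Data.Fin using (Fin; toℕ)
open import Data.Fin.Subset using (Subset; _∈_; _∉_)
open import Data.Product using (Σ; _×_; ∃)
open import Data.Sum using (_⊎_)
open import Data.Empty using (⊥)
open import Relation.Binary.PropositionalEquality using (_≡_)
open import Function.Definitions using (Injective)

CyclicOrder : ℕ → ℕ → ℕ → ℕ → Set
CyclicOrder a b c d =
    (a < b × b < c × c < d)
  ⊎ (b < c × c < d × d < a)
  ⊎ (c < d × d < a × a < b)
  ⊎ (d < a × a < b × b < c)

-- The cycle C has n ≥ 3 vertices, labelled Fin n in their order along C
-- (vertex i is adjacent to i+1 mod n).  Cyclic order of vertices of C:
CycOrd : ∀ {n} → Fin n → Fin n → Fin n → Fin n → Set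
CycOrd a b c d = CyclicOrder (toℕ a) (toℕ b) (toℕ c) (toℕ d)

Family : ℕ → ℕ → Set
Family n p = Fin p → Subset n

AxaxFree : ∀ {n p} → Family n p → Set
AxaxFree {n} {p} F =
  (i j : Fin p) (a₁ x₁ a₂ x₂ : Fin n) →
  CycOrd a₁ x₁ a₂ x₂ →
  a₁ ∈ F i → a₁ ∉ F j → a₂ ∈ F i → a₂ ∉ F j →
  x₁ ∈ F j → x₂ ∈ F j → ⊥

Meets : ∀ {n} → Subset n → Subset n → Set
Meets {n} A B = Σ (Fin n) λ v → v ∈ A × v ∈ B

IntersectionProperty : ∀ {n p q} → Family n p → Family n q → Set
IntersectionProperty {n} {p} {q} ℋ 𝒦 =
  (i : Fin p) (j : Fin q) (h₁ k₁ h₂ k₂ : Fin n) →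
  CycOrd h₁ k₁ h₂ k₂ →
  h₁ ∈ ℋ i → h₂ ∈ ℋ i → k₁ ∈ 𝒦 j → k₂ ∈ 𝒦 j →
  Meets (ℋ i) (𝒦 j)

StrongAxaxFree : ∀ {n p q} → Family n p → Family n q → Set
StrongAxaxFree ℋ 𝒦 = AxaxFree ℋ × AxaxFree 𝒦 × IntersectionProperty ℋ 𝒦

record Graph (p : ℕ) : Set₁ where
  field
    Adj   : Fin p → Fin p → Set
    sym   : ∀ {u v} → Adj u v → Adj v u
    irrefl : ∀ {u} → Adj u u → ⊥
open Graph public

data PathIn {p} (G : Graph p) (S : Fin p → Set) : Fin p → Fin p → Set where
  here : ∀ {u} → S u → PathIn G S u u
  step : ∀ {u w v} → S u → Adj G u w → PathIn G S w v → PathIn G S u v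

InducesConnected : ∀ {p} → Graph p → (Fin p → Set) → Set
InducesConnected {p} G S = (u v : Fin p) → S u → S v → PathIn G S u v

IsIntersectionSupport : ∀ {n p q} → Family n p → Family n q → Graph p → Set
IsIntersectionSupport {q = q} ℋ 𝒦 G =
  (j : Fin q) → InducesConnected G (λ i → Meets (ℋ i) (𝒦 j))

-- Outerplanar: the vertices can be placed at distinct positions on a circle
-- (injective σ) so that no two edges, drawn as chords, cross.
Outerplanar : ∀ {p} → Graph p → Set
Outerplanar {p} G =
  Σ (Fin p → Fin p) λ σ → Injective _≡_ _≡_ σ ×
    ((a b c d : Fin p) → Adj G a b → Adj G c d →
      CycOrd (σ a) (σ c) (σ b) (σ d) → ⊥)

{-# OPTIONS --safe #-}
module Submission where

-- Order ℋ by least element, breaking ties at the first difference, where the set that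
-- does not contain it comes first.  In this order, for K, L ∈ 𝒦, the sets meeting K but not L
-- never alternate with those meeting L but not K: four alternating sets would give two
-- crossing curves in the disc (one through K, one through L), and the order together with
-- the axax and intersection properties excludes every crossing of their pieces.
--
-- For any hypergraph on a linear order without such an alternation there is an
-- interior vertex v (an ear) such that every hyperedge through v is {v} or contains a neighbour
-- of v.  Indeed, delete the first vertex w and take an ear v of the rest; if it is not an
-- ear of the whole, then {w , v} is a hyperedge, no hyperedge avoiding w and v has
-- vertices on both sides of it, and an ear of the segment from w to v does the job.  Removing an ear, drawing the rest
-- recursively and joining the ear to its two neighbours gives an outerplanar support.

open import Defs
open import Data.Nat using (ℕ; zero; suc; _+_; _*_; _^_; _≤_; _<_; z≤n; s≤s; _<?_)
import Data.Nat.Properties as ℕ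
open import Data.Fin using (Fin; zero; suc; toℕ; fromℕ<)
open import Data.Fin.Properties using (any?; toℕ<n; toℕ-injective; toℕ-fromℕ<)
open import Data.Fin.Subset as Subset using (Subset; inside; outside; ∣_∣)
open import Data.Fin.Subset.Properties using (_∈?_; p⊂q⇒∣p∣<∣q∣; ∈⊤; ⊆⊤; ∣⊤∣≡n)
open import Data.Vec using ([]; _∷_; tabulate; here; there)
open import Data.Vec.Properties using (lookup∘tabulate; []=⇒lookup; lookup⇒[]=)
open import Data.List as List using (List; []; _∷_; _++_; length; allFin)
open import Data.List.Properties using (++-assoc; length-++)
open import Data.List.Membership.Propositional using (_∈_)
open import Data.List.Membership.Propositional.Properties using (∈-++⁻; ∈-++⁺ˡ; ∈-++⁺ʳ; ∈-allFin)
open import Data.List.Relation.Unary.Any using (here; there)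
open import Data.List.Relation.Unary.All as All using (All; []; _∷_)
open import Data.List.Relation.Unary.AllPairs using (AllPairs; []; _∷_)
open import Data.List.Relation.Binary.Sublist.Propositional using (_⊆_; []; _∷ʳ_; _∷_; ⊆-refl; lookup)
open import Data.List.Relation.Binary.Sublist.Propositional.Properties using (All-resp-⊆; ++⁺; ++⁺ˡ; ++⁺ʳ)
open import Data.Product using (Σ; ∃; _×_; _,_; proj₁; proj₂)
open import Data.Sum using (_⊎_; inj₁; inj₂)
open import Data.Empty using (⊥; ⊥-elim)
open import Function using (_∘_; case_of_)
open import Function.Definitions using (Injective)
open import Relation.Binary using (Rel; tri<; tri≈; tri>)
open import Relation.Nullary using (¬_; Dec; yes; no; does; contradiction)
open import Relation.Nullary.Decidable using (_×-dec_; ¬?; dec-true; dec-false; decidable-stable)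
open import Relation.Binary.PropositionalEquality using (_≡_; _≢_; refl; cong; subst) renaming (sym to ≡-sym; trans to ≡-trans)

private
  variable
    n p q : ℕ

<-or-> : ∀ {l m} → l ≢ m → l < m ⊎ m < l
<-or-> l≢m with ℕ.<-cmp _ _
... | tri< l<m _ _ = inj₁ l<m
... | tri≈ _ l≡m _ = contradiction l≡m l≢m
... | tri> _ _ m<l = inj₂ m<l

resolve : {A B C : Set} → ¬ A → ¬ B → A ⊎ B ⊎ C → C
resolve ¬a ¬b (inj₁ a)        = contradiction a ¬a
resolve ¬a ¬b (inj₂ (inj₁ b)) = contradiction b ¬b
resolve ¬a ¬b (inj₂ (inj₂ c)) = c

-- The order on subsets

-- The first vertex is the most significant digit, so comparing values means comparing the sets at
-- their first difference.
binary : Subset n → ℕ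
binary []                   = 0
binary (outside ∷ A)        = binary A
binary {suc n} (inside ∷ A) = 2 ^ n + binary A

binary<2^n : (A : Subset n) → binary A < 2 ^ n
binary<2^n []                    = s≤s z≤n
binary<2^n {suc n} (outside ∷ A) = ℕ.<-≤-trans (binary<2^n A) (ℕ.m≤m+n (2 ^ n) _)
binary<2^n {suc n} (inside ∷ A)  =
  ℕ.+-monoʳ-< (2 ^ n) (ℕ.<-≤-trans (binary<2^n A) (ℕ.≤-reflexive (≡-sym (ℕ.+-identityʳ (2 ^ n)))))

-- Comparing codes compares least elements first; the binary expansions of the
-- remainders then break ties.
code : Subset n → ℕ
code []                    = 0
code {suc n} (outside ∷ A) = 2 ^ n + code A
code (inside ∷ A)          = binary A

-- Refutes every case where the heads differ the wrong way: in `binary` and `code` alike, one head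
-- adds `2 ^ n` while the other side is just `binary` of a tail.
2^n+≰binary : ∀ {m} (A : Subset n) → ¬ 2 ^ n + m ≤ binary A
2^n+≰binary A le = ℕ.<⇒≱ (binary<2^n A) (ℕ.m+n≤o⇒m≤o _ le)

-- Common leading `outside` digits cancel, and the first `inside` must occur in `A`, possibly in
-- both sets at once. The witness is the least element of `A`.
code-≤⇒lower : {A B : Subset n} → code A ≤ code B →
  ∀ {b} → b Subset.∈ B → ∃ λ a → a Subset.∈ A × toℕ a ≤ toℕ b
code-≤⇒lower {A = inside ∷ A} le b∈B = zero , here , z≤n
code-≤⇒lower {A = outside ∷ A} {inside ∷ B} le b∈B = contradiction le (2^n+≰binary B)
code-≤⇒lower {A = outside ∷ A} {outside ∷ B} le (there b∈B)
  with a , a∈A , a≤b ← code-≤⇒lower {A = A} {B} (ℕ.+-cancelˡ-≤ _ _ _ le) b∈B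
  = suc a , there a∈A , s≤s a≤b

-- At the first difference the set with the greater value has the digit 1. Since `s` is a difference
-- of the opposite kind, the first one lies strictly before it.
binary-≤⇒earlier-difference : {A B : Subset n} → binary A ≤ binary B →
  ∀ {s} → s Subset.∈ A → s Subset.∉ B →
  ∃ λ e → toℕ e < toℕ s × e Subset.∈ B × e Subset.∉ A
binary-≤⇒earlier-difference {A = outside ∷ A} {inside ∷ B} le (there s∈A) s∉B =
  zero , s≤s z≤n , here , λ ()
binary-≤⇒earlier-difference {A = inside ∷ A} {outside ∷ B} le s∈A s∉B =
  contradiction le (2^n+≰binary B)
binary-≤⇒earlier-difference {A = inside ∷ A} {inside ∷ B} le here s∉B = contradiction here s∉B
binary-≤⇒earlier-difference {A = inside ∷ A} {inside ∷ B} le (there s∈A) s∉B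
  with e , e<s , e∈B , e∉A ←
    binary-≤⇒earlier-difference {A = A} {B} (ℕ.+-cancelˡ-≤ _ _ _ le) s∈A (s∉B ∘ there)
  = suc e , s≤s e<s , there e∈B , λ { (there e∈A) → e∉A e∈A }
binary-≤⇒earlier-difference {A = outside ∷ A} {outside ∷ B} le (there s∈A) s∉B
  with e , e<s , e∈B , e∉A ← binary-≤⇒earlier-difference {A = A} {B} le s∈A (s∉B ∘ there)
  = suc e , s≤s e<s , there e∈B , λ { (there e∈A) → e∉A e∈A }

-- In the first alternative `A` has the smaller least element, `m`. In the second the least elements
-- agree in `m`, and `e` is the first difference, which the tie-break puts into `B`.
code-≤⇒difference : {A B : Subset n} → code A ≤ code B →
  ∀ {s b} → s Subset.∈ A → s Subset.∉ B → b Subset.∈ B →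
    (∃ λ m → m Subset.∈ A × m Subset.∉ B × toℕ m < toℕ b)
  ⊎ (∃ λ m → ∃ λ e → m Subset.∈ A × toℕ m < toℕ e × toℕ e < toℕ s × e Subset.∈ B × e Subset.∉ A)
code-≤⇒difference {A = inside ∷ A} {outside ∷ B} le s∈A s∉B (there b∈B) =
  inj₁ (zero , here , (λ ()) , s≤s z≤n)
code-≤⇒difference {A = outside ∷ A} {inside ∷ B} le s∈A s∉B b∈B =
  contradiction le (2^n+≰binary B)
code-≤⇒difference {A = inside ∷ A} {inside ∷ B} le here s∉B b∈B = contradiction here s∉B
code-≤⇒difference {A = inside ∷ A} {inside ∷ B} le (there s∈A) s∉B b∈B
  with e , e<s , e∈B , e∉A ← binary-≤⇒earlier-difference {A = A} {B} le s∈A (s∉B ∘ there)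
  = inj₂ (zero , suc e , here , s≤s z≤n , s≤s e<s , there e∈B , λ { (there e∈A) → e∉A e∈A })
code-≤⇒difference {A = outside ∷ A} {outside ∷ B} le (there s∈A) s∉B (there b∈B)
  with code-≤⇒difference {A = A} {B} (ℕ.+-cancelˡ-≤ _ _ _ le) s∈A (s∉B ∘ there) b∈B
... | inj₁ (m , m∈A , m∉B , m<b) =
  inj₁ (suc m , there m∈A , (λ { (there m∈B) → m∉B m∈B }) , s≤s m<b)
... | inj₂ (m , e , m∈A , m<e , e<s , e∈B , e∉A) =
  inj₂ (suc m , suc e , there m∈A , s≤s m<e , s≤s e<s , there e∈B , λ { (there e∈A) → e∉A e∈A })

∈∉⇒≢ : {A : Subset n} {x y : Fin n} → x Subset.∈ A → y Subset.∉ A → toℕ x ≢ toℕ y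
∈∉⇒≢ {A = A} x∈A y∉A eq = y∉A (subst (Subset._∈ A) (toℕ-injective eq) x∈A)

-- Excluding alternations in a strong `axax`-free system

module _ {ℋ : Family n p} {𝒦 : Family n q} (strong : StrongAxaxFree ℋ 𝒦) where

  private
    ℋ-axax : AxaxFree ℋ
    ℋ-axax = proj₁ strong

    𝒦-axax : AxaxFree 𝒦
    𝒦-axax = proj₁ (proj₂ strong)

    meets : IntersectionProperty ℋ 𝒦
    meets = proj₂ (proj₂ strong)

  -- Otherwise `b < s < t`. A smaller least element `m` of `ℋ i` gives the forbidden pattern
  -- `m , b , s , t`; equal least elements give `m , e , s , t` with the roles of the two sets
  -- exchanged.
  chords-uncrossed : ∀ i j → code (ℋ i) ≤ code (ℋ j) →
    ∀ {s t b} → s Subset.∈ ℋ i → s Subset.∉ ℋ j → t Subset.∈ ℋ j → t Subset.∉ ℋ i → b Subset.∈ ℋ j →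
    toℕ s < toℕ b ⊎ toℕ t < toℕ s
  chords-uncrossed i j le {s} {t} {b} s∈i s∉j t∈j t∉i b∈j
    with <-or-> (∈∉⇒≢ s∈i t∉i) | <-or-> (∈∉⇒≢ b∈j s∉j)
  ... | inj₂ t<s | _        = inj₂ t<s
  ... | inj₁ s<t | inj₂ s<b = inj₁ s<b
  ... | inj₁ s<t | inj₁ b<s with code-≤⇒difference le s∈i s∉j b∈j
  ... | inj₁ (m , m∈i , m∉j , m<b) =
    ⊥-elim (ℋ-axax i j m b s t (inj₁ (m<b , b<s , s<t)) m∈i m∉j s∈i s∉j b∈j t∈j)
  ... | inj₂ (m , e , m∈i , m<e , e<s , e∈j , e∉i) =
    ⊥-elim (ℋ-axax j i e s t m (inj₂ (inj₂ (inj₂ (m<e , e<s , s<t)))) e∈j e∉i t∈j t∉i s∈i m∈i)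

  -- Join `a , kA , kD , d` by chords inside `ℋ A`, `𝒦 k`, `ℋ D`, and `u , lU , lY` by chords inside
  -- `ℋ U`, `𝒦 l`. As `a ≤ u ≤ d < lY`, the two curves cannot avoid each other. But two chords from
  -- `ℋ` are kept apart by `chords-uncrossed`, two from `𝒦` by the axax property, and a mixed
  -- crossing would make a set meet a member of `𝒦` that it misses.
  no-alternation : ∀ k l {A U D Y} →
    code (ℋ A) ≤ code (ℋ U) → code (ℋ U) ≤ code (ℋ D) → code (ℋ D) ≤ code (ℋ Y) →
    Meets (ℋ A) (𝒦 k) → ¬ Meets (ℋ A) (𝒦 l) →
    Meets (ℋ U) (𝒦 l) → ¬ Meets (ℋ U) (𝒦 k) →
    Meets (ℋ D) (𝒦 k) → ¬ Meets (ℋ D) (𝒦 l) →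
    Meets (ℋ Y) (𝒦 l) → ⊥
  no-alternation k l {A} {U} {D} {Y} A≤U U≤D D≤Y
    (kA , kA∈A , kA∈k) A∦l (lU , lU∈U , lU∈l) U∦k (kD , kD∈D , kD∈k) D∦l (lY , lY∈Y , lY∈l)
    = result
    where
    lower : ∀ {i j} → code (ℋ i) ≤ code (ℋ j) → ∀ {c b} → c Subset.∈ ℋ i → b Subset.∈ ℋ j →
      ∃ λ a → a Subset.∈ ℋ i × toℕ a ≤ toℕ c × toℕ a ≤ toℕ b
    lower {i} {j} le {c} c∈i b∈j with code-≤⇒lower le b∈j
    ... | a , a∈i , a≤b with ℕ.≤-total (toℕ a) (toℕ c)
    ... | inj₁ a≤c = a , a∈i , a≤c , a≤b
    ... | inj₂ c≤a = c , c∈i , ℕ.≤-refl , ℕ.≤-trans c≤a a≤b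

    apart : ∀ {i j} → ¬ Meets (ℋ i) (𝒦 j) →
      ∀ {x y} → x Subset.∈ ℋ i → y Subset.∈ 𝒦 j → toℕ x ≢ toℕ y
    apart i∦j x∈i y∈j = ∈∉⇒≢ x∈i (λ y∈i → i∦j (_ , y∈i , y∈j))

    kA∉l : kA Subset.∉ 𝒦 l
    kA∉l kA∈l = A∦l (kA , kA∈A , kA∈l)

    kD∉l : kD Subset.∉ 𝒦 l
    kD∉l kD∈l = D∦l (kD , kD∈D , kD∈l)

    -- The low ends are chosen from right to left, each bounded by the previous choice: `d` by `lY`,
    -- `u` by `d`, `a` by `u`.
    d,≤ = lower D≤Y kD∈D lY∈Y
    d   = proj₁ d,≤
    d∈D = proj₁ (proj₂ d,≤)
    d≤kD = proj₁ (proj₂ (proj₂ d,≤))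

    u,≤ = lower U≤D lU∈U d∈D
    u   = proj₁ u,≤
    u∈U = proj₁ (proj₂ u,≤)
    u≤lU = proj₁ (proj₂ (proj₂ u,≤))

    a,≤ = lower A≤U kA∈A u∈U
    a   = proj₁ a,≤
    a∈A = proj₁ (proj₂ a,≤)

    -- Equality is ruled out because the two points lie in disjoint sets.
    d<lY : toℕ d < toℕ lY
    d<lY = ℕ.≤∧≢⇒< (proj₂ (proj₂ (proj₂ d,≤))) (apart D∦l d∈D lY∈l)

    u<kD : toℕ u < toℕ kD
    u<kD = ℕ.≤∧≢⇒< (ℕ.≤-trans (proj₂ (proj₂ (proj₂ u,≤))) d≤kD) (apart U∦k u∈U kD∈k)

    a<lU : toℕ a < toℕ lU
    a<lU = ℕ.≤∧≢⇒< (ℕ.≤-trans (proj₂ (proj₂ (proj₂ a,≤))) u≤lU) (apart A∦l a∈A lU∈l)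

    A-U : toℕ kA < toℕ u ⊎ toℕ lU < toℕ kA
    A-U = chords-uncrossed A U A≤U kA∈A (λ m → U∦k (kA , m , kA∈k)) lU∈U (λ m → A∦l (lU , m , lU∈l)) u∈U

    U-D : toℕ lU < toℕ d ⊎ toℕ kD < toℕ lU
    U-D = chords-uncrossed U D U≤D lU∈U (λ m → D∦l (lU , m , lU∈l)) kD∈D (λ m → U∦k (kD , m , kD∈k)) d∈D

    D-l : toℕ lU < toℕ d → toℕ lY < toℕ kD → ⊥
    D-l lU<d lY<kD = D∦l (meets D l d lY kD lU (inj₂ (inj₂ (inj₂ (lU<d , d<lY , lY<kD)))) d∈D kD∈D lY∈l lU∈l)

    result : ⊥
    -- `A-U` puts `kA` outside the interval from `u` to `lU`, so `kD` inside it would make `𝒦 k`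
    -- cross `ℋ U`. Otherwise the position of `lY` shows which chord that of `𝒦 l` crosses.
    result with A-U
    ... | inj₁ kA<u with U-D
    ...   | inj₂ kD<lU =
            U∦k (meets U k u kD lU kA (inj₂ (inj₂ (inj₂ (kA<u , u<kD , kD<lU)))) u∈U lU∈U kD∈k kA∈k)
    ...   | inj₁ lU<d with <-or-> (∈∉⇒≢ lY∈l kD∉l)
    ...     | inj₁ lY<kD = D-l lU<d lY<kD
    ...     | inj₂ kD<lY =
              𝒦-axax k l kA lU kD lY
                (inj₁ (ℕ.<-≤-trans kA<u u≤lU , ℕ.<-≤-trans lU<d d≤kD , kD<lY))
                kA∈k kA∉l kD∈k kD∉l lU∈l lY∈l
    result | inj₂ lU<kA with <-or-> (∈∉⇒≢ lY∈l kA∉l)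
    ...   | inj₂ kA<lY =
            A∦l (meets A l a lU kA lY (inj₁ (a<lU , lU<kA , kA<lY)) a∈A kA∈A lU∈l lY∈l)
    ...   | inj₁ lY<kA with U-D
    ...     | inj₂ kD<lU =
              U∦k (meets U k u kD lU kA (inj₁ (u<kD , kD<lU , lU<kA)) u∈U lU∈U kD∈k kA∈k)
    ...     | inj₁ lU<d with <-or-> (∈∉⇒≢ lY∈l kD∉l)
    ...       | inj₁ lY<kD = D-l lU<d lY<kD
    ...       | inj₂ kD<lY =
                𝒦-axax k l kD lY kA lU
                  (inj₂ (inj₂ (inj₂ (ℕ.<-≤-trans lU<d d≤kD , kD<lY , lY<kA))))
                  kD∈k kD∉l kA∈k kA∉l lY∈l lU∈l

-- Ears

AllPairs-resp-⊆ : ∀ {a r} {X : Set a} {R : Rel X r} {xs ys : List X} → xs ⊆ ys → AllPairs R ys → AllPairs R xs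
AllPairs-resp-⊆ []          []         = []
AllPairs-resp-⊆ (_ ∷ʳ τ)    (_ ∷ Rys)  = AllPairs-resp-⊆ τ Rys
AllPairs-resp-⊆ (refl ∷ τ)  (Ry ∷ Rys) = All-resp-⊆ τ Ry ∷ AllPairs-resp-⊆ τ Rys

AllPairs-++⁻ : ∀ {a r} {X : Set a} {R : Rel X r} xs {ys : List X} → AllPairs R (xs ++ ys) →
  ∀ {x y} → x ∈ xs → y ∈ ys → R x y
AllPairs-++⁻ (_ ∷ xs) (Rx ∷ _)  (here refl) y∈ys = All.lookup Rx (∈-++⁺ʳ xs y∈ys)
AllPairs-++⁻ (_ ∷ xs) (_ ∷ Rxs) (there x∈xs) y∈ys = AllPairs-++⁻ xs Rxs x∈xs y∈ys

module _ (key : Fin p → ℕ) where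

  infix 4 _≺_
  _≺_ : Fin p → Fin p → Set
  x ≺ y = key x < key y

  Sorted : List (Fin p) → Set
  Sorted = AllPairs _≺_

  head-least : ∀ {x xs} → Sorted (x ∷ xs) → ∀ {z} → z ∈ x ∷ xs → key x ≤ key z
  head-least _           (here refl)  = ℕ.≤-refl
  head-least (x≺xs ∷ _)  (there z∈xs) = ℕ.<⇒≤ (All.lookup x≺xs z∈xs)

  last-greatest : ∀ xs {y} → Sorted (xs ++ y ∷ []) → ∀ {z} → z ∈ xs ++ y ∷ [] → key z ≤ key y
  last-greatest xs sorted z∈ with ∈-++⁻ xs z∈
  ... | inj₁ z∈xs        = ℕ.<⇒≤ (AllPairs-++⁻ xs sorted z∈xs (here refl))
  ... | inj₂ (here refl) = ℕ.≤-refl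

  module _ (pre : List (Fin p)) {x v y post} (sorted : Sorted (pre ++ x ∷ v ∷ y ∷ post)) where

    private
      suffix : Sorted (x ∷ v ∷ y ∷ post)
      suffix = AllPairs-resp-⊆ (++⁺ˡ pre ⊆-refl) sorted

    left≺middle : x ≺ v
    left≺middle with (x≺v ∷ _) ∷ _ ← suffix = x≺v

    middle≺right : v ≺ y
    middle≺right with _ ∷ (v≺y ∷ _) ∷ _ ← suffix = v≺y

    trichotomy : ∀ {z} → z ∈ pre ++ x ∷ v ∷ y ∷ post → key z ≤ key x ⊎ z ≡ v ⊎ key y ≤ key z
    trichotomy z∈ with ∈-++⁻ pre z∈
    ... | inj₁ z∈pre               = inj₁ (ℕ.<⇒≤ (AllPairs-++⁻ pre sorted z∈pre (here refl)))
    ... | inj₂ (here refl)         = inj₁ ℕ.≤-refl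
    ... | inj₂ (there (here refl)) = inj₂ (inj₁ refl)
    ... | inj₂ (there (there z∈)) with _ ∷ _ ∷ y∷post ← suffix = inj₂ (inj₂ (head-least y∷post z∈))

  module _ (S : Fin q → Fin p → Set) where

    AbabFree : Set
    AbabFree = ∀ k l {a b c d} → a ≺ b → b ≺ c → c ≺ d →
      S k a → ¬ S l a → S l b → ¬ S k b → S k c → ¬ S l c → S l d → ¬ S k d → ⊥

    -- The last alternative of `ear` looks at `xs` alone: a hyperedge may have vertices outside the
    -- list under consideration.
    record Ear (xs : List (Fin p)) : Set where
      constructor mkEar
      field
        pre post : List (Fin p)
        {x v y}  : Fin p
        split    : xs ≡ pre ++ x ∷ v ∷ y ∷ post
        ear      : ∀ k → S k v → S k x ⊎ S k y ⊎ (∀ {z} → z ∈ xs → S k z → z ≡ v)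

    module _ (S? : ∀ k x → Dec (S k x)) (abab : AbabFree) where

      -- The bound `m` serves termination: the second recursive call is on `segment`, which is not a
      -- structural part of the list.
      findEar : ∀ m xs → length xs ≤ m → 3 ≤ length xs → Sorted xs → Ear xs
      findEar m (_ ∷ [])     _ (s≤s ())       _
      findEar m (_ ∷ _ ∷ []) _ (s≤s (s≤s ())) _
      findEar m (x ∷ v ∷ y ∷ []) _ _ _ = mkEar [] [] refl ear
        where
        ear : ∀ k → S k v → S k x ⊎ S k y ⊎ (∀ {z} → z ∈ x ∷ v ∷ y ∷ [] → S k z → z ≡ v)
        ear k _ with S? k x | S? k y
        ... | yes Sx | _      = inj₁ Sx
        ... | no _   | yes Sy = inj₂ (inj₁ Sy)
        ... | no ¬Sx | no ¬Sy = inj₂ (inj₂ λ where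
          (here refl) Sz                 → contradiction Sz ¬Sx
          (there (here refl)) Sz         → refl
          (there (there (here refl))) Sz → contradiction Sz ¬Sy)
      findEar (suc m) (w ∷ xs@(_ ∷ _ ∷ _ ∷ _)) (s≤s len) _ sorted@(_ ∷ sorted-xs)
        with findEar m xs len (s≤s (s≤s (s≤s z≤n))) sorted-xs
      ... | mkEar pre post {x} {v} {y} eq ear
        -- Only a hyperedge through `w` can spoil `v`: one that is `{v}` on `xs` and becomes
        -- `{w , v}`.
        with any? (λ k → S? k v ×-dec ¬? (S? k x) ×-dec ¬? (S? k y) ×-dec S? k w)
      ... | no none = mkEar (w ∷ pre) post (cong (w ∷_) eq) ear′
        where
        ear′ : ∀ k → S k v → S k x ⊎ S k y ⊎ (∀ {z} → z ∈ w ∷ xs → S k z → z ≡ v)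
        ear′ k Sv with S? k x | S? k y
        ... | yes Sx | _      = inj₁ Sx
        ... | no _   | yes Sy = inj₂ (inj₁ Sy)
        ... | no ¬Sx | no ¬Sy = inj₂ (inj₂ λ where
          (here refl) Sw   → contradiction (k , Sv , ¬Sx , ¬Sy , Sw) none
          (there z∈xs) Sz → resolve ¬Sx ¬Sy (ear k Sv) z∈xs Sz)
      ... | yes (k , Sv , ¬Sx , ¬Sy , Sw) = mkEar E.pre (E.post ++ y ∷ post) whole-split ear′
        where
        only-v : ∀ {z} → z ∈ xs → S k z → z ≡ v
        only-v = resolve ¬Sx ¬Sy (ear k Sv)

        init : List (Fin p)
        init = w ∷ pre ++ x ∷ []

        segment : List (Fin p)
        segment = init ++ v ∷ []

        whole : w ∷ xs ≡ segment ++ y ∷ post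
        whole = cong (w ∷_) (≡-trans eq (≡-sym
          (≡-trans (++-assoc (pre ++ x ∷ []) (v ∷ []) (y ∷ post)) (++-assoc pre (x ∷ []) (v ∷ y ∷ post)))))

        sorted-whole : Sorted (segment ++ y ∷ post)
        sorted-whole = subst Sorted whole sorted

        sorted-segment : Sorted segment
        sorted-segment = AllPairs-resp-⊆ (++⁺ʳ (y ∷ post) ⊆-refl) sorted-whole

        segment-short : length segment ≤ m
        segment-short = ℕ.≤-pred (ℕ.≤-trans
          (ℕ.≤-trans (ℕ.≤-trans (ℕ.≤-reflexive (ℕ.+-comm 1 _)) (ℕ.+-monoʳ-≤ (length segment) (s≤s z≤n)))
            (ℕ.≤-reflexive (≡-trans (≡-sym (length-++ segment)) (cong length (≡-sym whole)))))
          (s≤s len))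

        segment-long : 3 ≤ length segment
        segment-long = s≤s (ℕ.≤-trans
          (ℕ.+-mono-≤ (ℕ.≤-trans (ℕ.m≤n+m 1 (length pre)) (ℕ.≤-reflexive (≡-sym (length-++ pre)))) ℕ.≤-refl)
          (ℕ.≤-reflexive (≡-sym (length-++ (pre ++ x ∷ [])))))

        E = findEar m segment segment-short segment-long sorted-segment
        module E = Ear E

        -- The segment is contiguous in the list, so its ear keeps the same neighbours in the whole.
        whole-split : w ∷ xs ≡ E.pre ++ E.x ∷ E.v ∷ E.y ∷ E.post ++ y ∷ post
        whole-split = ≡-trans whole (≡-trans (cong (_++ y ∷ post) E.split) (++-assoc E.pre _ (y ∷ post)))

        sorted-E : Sorted (E.pre ++ E.x ∷ E.v ∷ E.y ∷ E.post)
        sorted-E = subst Sorted E.split sorted-segment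

        in-segment : ∀ {z} → z ∈ E.x ∷ E.v ∷ E.y ∷ E.post → z ∈ segment
        in-segment z∈ = subst (_ ∈_) (≡-sym E.split) (∈-++⁺ʳ E.pre z∈)

        w≺ear : w ≺ E.v
        w≺ear = ℕ.≤-<-trans (head-least sorted-segment (in-segment (here refl))) (left≺middle E.pre sorted-E)

        ear≺v : E.v ≺ v
        ear≺v = ℕ.<-≤-trans (middle≺right E.pre sorted-E)
          (last-greatest init sorted-segment (in-segment (there (there (here refl)))))

        v∈segment : v ∈ segment
        v∈segment = ∈-++⁺ʳ init (here refl)

        after : ∀ {z} → z ∈ y ∷ post → v ≺ z
        after = AllPairs-++⁻ segment sorted-whole v∈segment

        ear∈xs : E.v ∈ xs
        ear∈xs with subst (E.v ∈_) (≡-sym whole) (∈-++⁺ˡ (in-segment (there (here refl))))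
        ... | here eq′  = contradiction (cong key (≡-sym eq′)) (ℕ.<⇒≢ w≺ear)
        ... | there ∈xs = ∈xs

        after∈xs : ∀ {z} → z ∈ y ∷ post → z ∈ xs
        after∈xs z∈ = subst (_ ∈_) (≡-sym eq) (∈-++⁺ʳ pre (there (there z∈)))

        ear′ : ∀ l → S l E.v → S l E.x ⊎ S l E.y ⊎ (∀ {z} → z ∈ w ∷ xs → S l z → z ≡ E.v)
        ear′ l Su with E.ear l Su
        ... | inj₁ Sx          = inj₁ Sx
        ... | inj₂ (inj₁ Sy)   = inj₂ (inj₁ Sy)
        ... | inj₂ (inj₂ only) = inj₂ (inj₂ λ {z} z∈ Sz → case ∈-++⁻ segment (subst (z ∈_) whole z∈) of λ where
          (inj₁ z∈segment) → only z∈segment Sz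
          -- With `z` in `l`, the vertices `w , E.v , v , z` would alternate between `k` and `l`: on
          -- the list `k` has only `w` and `v`, and inside the segment `l` has only `E.v`.
          (inj₂ z∈after)   → ⊥-elim (abab k l w≺ear ear≺v (after z∈after)
            Sw (λ Slw → ℕ.<⇒≢ w≺ear (cong key (only (here refl) Slw)))
            Su (λ Sku → ℕ.<⇒≢ ear≺v (cong key (only-v ear∈xs Sku)))
            Sv (λ Slv → ℕ.<⇒≢ ear≺v (cong key (≡-sym (only v∈segment Slv))))
            Sz (λ Skz → ℕ.<⇒≢ (after z∈after) (cong key (≡-sym (only-v (after∈xs z∈after) Skz))))))

-- Drawing the support

noEdges : ∀ p → Graph p
noEdges p = record { Adj = λ _ _ → ⊥ ; sym = λ () ; irrefl = λ () }

addEdge : (G : Graph p) (x y : Fin p) → x ≢ y → Graph p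
addEdge G x y x≢y = record
  { Adj    = λ a b → Adj G a b ⊎ (a ≡ x × b ≡ y) ⊎ (a ≡ y × b ≡ x)
  ; sym    = λ where
      (inj₁ e)                 → inj₁ (Graph.sym G e)
      (inj₂ (inj₁ (a≡x , b≡y))) → inj₂ (inj₂ (b≡y , a≡x))
      (inj₂ (inj₂ (a≡y , b≡x))) → inj₂ (inj₁ (b≡x , a≡y))
  ; irrefl = λ where
      (inj₁ e)                  → irrefl G e
      (inj₂ (inj₁ (refl , x≡y))) → x≢y x≡y
      (inj₂ (inj₂ (refl , y≡x))) → x≢y (≡-sym y≡x)
  }

PathIn-map : {G H : Graph p} {P : Fin p → Set} → (∀ {a b} → Adj G a b → Adj H a b) →
  ∀ {u v} → PathIn G P u v → PathIn H P u v
PathIn-map f (here Pu)     = here Pu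
PathIn-map f (step Pu e π) = step Pu (f e) (PathIn-map f π)

PathIn-snoc : {G : Graph p} {P : Fin p → Set} → ∀ {u w v} →
  PathIn G P u w → Adj G w v → P v → PathIn G P u v
PathIn-snoc (here Pu)     e Pv = step Pu e (here Pv)
PathIn-snoc (step Pu d π) e Pv = step Pu d (PathIn-snoc π e Pv)

SupportedOn : (Fin q → Fin p → Set) → List (Fin p) → Graph p → Set
SupportedOn S xs G = ∀ k {u v} → u ∈ xs → v ∈ xs → S k u → S k v → PathIn G (S k) u v

module _ (key : Fin p → ℕ) where

  -- Edges are arcs above a line ordered by `key`. One pattern is enough for `uncrossed`, and one
  -- end for `endpoint`, because `Adj` is symmetric and the two edges can be exchanged.
  record DrawnOn (xs : List (Fin p)) (G : Graph p) : Set where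
    field
      endpoint  : ∀ {a b} → Adj G a b → a ∈ xs
      uncrossed : ∀ {a b c d} → key a < key c → key c < key b → key b < key d →
        Adj G a b → Adj G c d → ⊥
  open DrawnOn

  -- The new arc has no vertex of `ys` strictly beneath it, whereas an arc crossing it would need an
  -- end there.
  addEdge-drawn : ∀ {xs ys G} → DrawnOn xs G → (∀ {z} → z ∈ xs → z ∈ ys) →
    ∀ {x y} (x≢y : x ≢ y) → key x < key y → x ∈ ys → y ∈ ys →
    (∀ {z} → z ∈ ys → key x < key z → key z < key y → ⊥) →
    DrawnOn ys (addEdge G x y x≢y)
  addEdge-drawn {ys = ys} {G} drawn xs⊆ys {x} {y} x≢y x<y x∈ys y∈ys gap = record
    { endpoint = endpoint′ ; uncrossed = uncrossed′ }
    where
    G′ = addEdge G x y x≢y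

    endpoint′ : ∀ {a b} → Adj G′ a b → a ∈ ys
    endpoint′ (inj₁ e)                 = xs⊆ys (endpoint drawn e)
    endpoint′ (inj₂ (inj₁ (refl , _))) = x∈ys
    endpoint′ (inj₂ (inj₂ (refl , _))) = y∈ys

    uncrossed′ : ∀ {a b c d} → key a < key c → key c < key b → key b < key d →
      Adj G′ a b → Adj G′ c d → ⊥
    uncrossed′ a<c c<b b<d (inj₁ e) (inj₁ f) = uncrossed drawn a<c c<b b<d e f
    uncrossed′ a<c c<b b<d (inj₂ (inj₁ (refl , refl))) f = gap (endpoint′ f) a<c c<b
    uncrossed′ a<c c<b b<d (inj₂ (inj₂ (refl , refl))) f = ℕ.<-asym x<y (ℕ.<-trans a<c c<b)
    uncrossed′ a<c c<b b<d e@(inj₁ _) (inj₂ (inj₁ (refl , refl))) = gap (endpoint′ (Graph.sym G′ e)) c<b b<d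
    uncrossed′ a<c c<b b<d e@(inj₁ _) (inj₂ (inj₂ (refl , refl))) = ℕ.<-asym x<y (ℕ.<-trans c<b b<d)

  noEdges-drawn : ∀ {xs} → DrawnOn xs (noEdges p)
  noEdges-drawn = record { endpoint = λ () ; uncrossed = λ _ _ _ () }

  ≺⇒≢ : ∀ {x y} → key x < key y → x ≢ y
  ≺⇒≢ x<y refl = ℕ.<-irrefl refl x<y

  module _ (S : Fin q → Fin p → Set) (S? : ∀ k x → Dec (S k x)) (abab : AbabFree key S) where

    -- A hyperedge through the ear `v` that has other vertices in the list contains `x` or `y`, so
    -- paths from `v` enter the rest there. Paths between other vertices come from the smaller
    -- drawing.
    drawSupport : ∀ m xs → length xs ≤ m → Sorted key xs →
      Σ (Graph p) λ G → DrawnOn xs G × SupportedOn S xs G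
    drawSupport m [] _ _ = noEdges p , noEdges-drawn , λ _ ()
    drawSupport m (x ∷ []) _ _ = noEdges p , noEdges-drawn , λ where
      _ (here refl) (here refl) Sx _ → here Sx
    drawSupport m (x ∷ y ∷ []) _ ((x≺y ∷ _) ∷ _) =
      addEdge (noEdges p) x y x≢y ,
      addEdge-drawn noEdges-drawn (λ z∈ → z∈) x≢y x≺y (here refl) (there (here refl)) (λ where
        (here refl)         x<x _ → ℕ.<-irrefl refl x<x
        (there (here refl)) _ y<y → ℕ.<-irrefl refl y<y) ,
      λ where
        _ (here refl)         (here refl)         Sx _  → here Sx
        _ (here refl)         (there (here refl)) Sx Sy → step Sx (inj₂ (inj₁ (refl , refl))) (here Sy)
        _ (there (here refl)) (here refl)         Sy Sx → step Sy (inj₂ (inj₂ (refl , refl))) (here Sx)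
        _ (there (here refl)) (there (here refl)) Sy _  → here Sy
      where
      x≢y = ≺⇒≢ x≺y
    drawSupport (suc m) xs@(_ ∷ _ ∷ _ ∷ _) len sorted
      with findEar key S S? abab (suc m) xs len (s≤s (s≤s (s≤s z≤n))) sorted
    ... | mkEar pre post {x} {v} {y} eq ear = G , drawn , supported
      where
      rest : List (Fin p)
      rest = pre ++ x ∷ y ∷ post

      sorted′ : Sorted key (pre ++ x ∷ v ∷ y ∷ post)
      sorted′ = subst (Sorted key) eq sorted

      rest⊆ : rest ⊆ pre ++ x ∷ v ∷ y ∷ post
      rest⊆ = ++⁺ (⊆-refl {x = pre}) (refl ∷ (v ∷ʳ ⊆-refl))

      in-xs : ∀ {z} → z ∈ pre ++ x ∷ v ∷ y ∷ post → z ∈ xs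
      in-xs {z} = subst (z ∈_) (≡-sym eq)

      x≺v : key x < key v
      x≺v = left≺middle key pre sorted′

      v≺y : key v < key y
      v≺y = middle≺right key pre sorted′

      rest-length : suc (length rest) ≡ length xs
      rest-length = ≡-sym (≡-trans (cong length eq) (≡-trans (length-++ pre)
        (≡-trans (ℕ.+-suc (length pre) _) (cong suc (≡-sym (length-++ pre))))))

      recursive : Σ (Graph p) λ G → DrawnOn rest G × SupportedOn S rest G
      recursive = drawSupport m rest (ℕ.≤-pred (ℕ.≤-trans (ℕ.≤-reflexive rest-length) len))
        (AllPairs-resp-⊆ rest⊆ sorted′)

      G₀ = proj₁ recursive
      G₁ = addEdge G₀ x v (≺⇒≢ x≺v)
      G  = addEdge G₁ v y (≺⇒≢ v≺y)

      x∈ : x ∈ xs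
      x∈ = in-xs (∈-++⁺ʳ pre (here refl))

      v∈ : v ∈ xs
      v∈ = in-xs (∈-++⁺ʳ pre (there (here refl)))

      y∈ : y ∈ xs
      y∈ = in-xs (∈-++⁺ʳ pre (there (there (here refl))))

      around : ∀ {z} → z ∈ xs → key z ≤ key x ⊎ z ≡ v ⊎ key y ≤ key z
      around {z} z∈ = trichotomy key pre sorted′ (subst (z ∈_) eq z∈)

      gap₁ : ∀ {z} → z ∈ xs → key x < key z → key z < key v → ⊥
      gap₁ z∈ x<z z<v with around z∈
      ... | inj₁ z≤x         = ℕ.<⇒≱ x<z z≤x
      ... | inj₂ (inj₁ refl) = ℕ.<-irrefl refl z<v
      ... | inj₂ (inj₂ y≤z)  = ℕ.<⇒≱ (ℕ.<-trans z<v v≺y) y≤z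

      gap₂ : ∀ {z} → z ∈ xs → key v < key z → key z < key y → ⊥
      gap₂ z∈ v<z z<y with around z∈
      ... | inj₁ z≤x         = ℕ.<⇒≱ (ℕ.<-trans x≺v v<z) z≤x
      ... | inj₂ (inj₁ refl) = ℕ.<-irrefl refl v<z
      ... | inj₂ (inj₂ y≤z)  = ℕ.<⇒≱ z<y y≤z

      drawn : DrawnOn xs G
      drawn = addEdge-drawn
        (addEdge-drawn (proj₁ (proj₂ recursive)) (λ z∈ → in-xs (lookup rest⊆ z∈)) (≺⇒≢ x≺v) x≺v x∈ v∈ gap₁)
        (λ z∈ → z∈) (≺⇒≢ v≺y) v≺y v∈ y∈ gap₂

      old : ∀ k {s t} → s ∈ rest → t ∈ rest → S k s → S k t → PathIn G (S k) s t
      old k s∈ t∈ Ss St = PathIn-map (inj₁ ∘ inj₁) (proj₂ (proj₂ recursive) k s∈ t∈ Ss St)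

      x∈rest : x ∈ rest
      x∈rest = ∈-++⁺ʳ pre (here refl)

      y∈rest : y ∈ rest
      y∈rest = ∈-++⁺ʳ pre (there (here refl))

      vx : Adj G v x
      vx = inj₁ (inj₂ (inj₂ (refl , refl)))

      vy : Adj G v y
      vy = inj₂ (inj₁ (refl , refl))

      v-or-rest : ∀ {z} → z ∈ xs → z ≡ v ⊎ z ∈ rest
      v-or-rest {z} z∈ with ∈-++⁻ pre (subst (z ∈_) eq z∈)
      ... | inj₁ z∈pre               = inj₂ (∈-++⁺ˡ z∈pre)
      ... | inj₂ (here refl)         = inj₂ x∈rest
      ... | inj₂ (there (here refl)) = inj₁ refl
      ... | inj₂ (there (there z∈′)) = inj₂ (∈-++⁺ʳ pre (there z∈′))

      supported : SupportedOn S xs G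
      supported k {s} {t} s∈ t∈ Ss St with v-or-rest s∈ | v-or-rest t∈
      ... | inj₂ s∈rest | inj₂ t∈rest = old k s∈rest t∈rest Ss St
      ... | inj₁ refl   | inj₁ refl   = here Ss
      ... | inj₁ refl   | inj₂ t∈rest with ear k Ss
      ...   | inj₁ Sx          = step Ss vx (old k x∈rest t∈rest Sx St)
      ...   | inj₂ (inj₁ Sy)   = step Ss vy (old k y∈rest t∈rest Sy St)
      ...   | inj₂ (inj₂ only) with refl ← only t∈ St = here Ss
      supported k {s} {t} s∈ t∈ Ss St | inj₂ s∈rest | inj₁ refl with ear k St
      ...   | inj₁ Sx          = PathIn-snoc (old k s∈rest x∈rest Ss Sx) (Graph.sym G vx) St
      ...   | inj₂ (inj₁ Sy)   = PathIn-snoc (old k s∈rest y∈rest Ss Sy) (Graph.sym G vy) St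
      ...   | inj₂ (inj₂ only) with refl ← only s∈ Ss = here Ss

-- Sorting and ranking by an injective key

module _ (key : Fin p → ℕ) (key-injective : Injective _≡_ _≡_ key) where

  insert : Fin p → List (Fin p) → List (Fin p)
  insert x []       = x ∷ []
  insert x (y ∷ ys) with ℕ.<-cmp (key x) (key y)
  ... | tri< _ _ _ = x ∷ y ∷ ys
  -- By injectivity `x` is `y`; leaving it out keeps the list strictly increasing.
  ... | tri≈ _ _ _ = y ∷ ys
  ... | tri> _ _ _ = y ∷ insert x ys

  All-insert : ∀ {P : Fin p → Set} {x} ys → P x → All P ys → All P (insert x ys)
  All-insert []       Px [] = Px ∷ []
  All-insert {x = x} (y ∷ ys) Px (Py ∷ Pys) with ℕ.<-cmp (key x) (key y)
  ... | tri< _ _ _ = Px ∷ Py ∷ Pys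
  ... | tri≈ _ _ _ = Py ∷ Pys
  ... | tri> _ _ _ = Py ∷ All-insert ys Px Pys

  insert-sorted : ∀ x {ys} → Sorted key ys → Sorted key (insert x ys)
  insert-sorted x {[]}     []           = [] ∷ []
  insert-sorted x {y ∷ ys} (y≺ys ∷ sorted) with ℕ.<-cmp (key x) (key y)
  ... | tri< x<y _ _ = (x<y ∷ All.map (ℕ.<-trans x<y) y≺ys) ∷ y≺ys ∷ sorted
  ... | tri≈ _ _ _   = y≺ys ∷ sorted
  ... | tri> _ _ y<x = All-insert ys y<x y≺ys ∷ insert-sorted x sorted

  ∈-insert-new : ∀ x ys → x ∈ insert x ys
  ∈-insert-new x []       = here refl
  ∈-insert-new x (y ∷ ys) with ℕ.<-cmp (key x) (key y)
  ... | tri< _ _ _   = here refl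
  ... | tri≈ _ x≡y _ = here (key-injective x≡y)
  ... | tri> _ _ _   = there (∈-insert-new x ys)

  ∈-insert-old : ∀ x {ys z} → z ∈ ys → z ∈ insert x ys
  ∈-insert-old x {y ∷ ys} z∈ with ℕ.<-cmp (key x) (key y)
  ∈-insert-old x z∈           | tri< _ _ _ = there z∈
  ∈-insert-old x z∈           | tri≈ _ _ _ = z∈
  ∈-insert-old x (here refl)  | tri> _ _ _ = here refl
  ∈-insert-old x (there z∈)   | tri> _ _ _ = there (∈-insert-old x z∈)

  sort : List (Fin p) → List (Fin p)
  sort = List.foldr insert []

  sort-sorted : ∀ xs → Sorted key (sort xs)
  sort-sorted []       = []
  sort-sorted (x ∷ xs) = insert-sorted x (sort-sorted xs)

  ∈-sort : ∀ {xs z} → z ∈ xs → z ∈ sort xs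
  ∈-sort {x ∷ xs} (here refl) = ∈-insert-new x (sort xs)
  ∈-sort {x ∷ xs} (there z∈)  = ∈-insert-old x (∈-sort z∈)

  below : Fin p → Subset p
  below i = tabulate (λ j → does (key j <? key i))

  ∈-below⁺ : ∀ {i j} → key j < key i → j Subset.∈ below i
  ∈-below⁺ {i} {j} j<i = lookup⇒[]= j _
    (≡-trans (lookup∘tabulate _ j) (dec-true (key j <? key i) j<i))

  ∈-below⁻ : ∀ {i j} → j Subset.∈ below i → key j < key i
  ∈-below⁻ {i} {j} j∈ = decidable-stable (key j <? key i) λ j≮i → case
    ≡-trans (≡-sym (dec-false (key j <? key i) j≮i)) (≡-trans (≡-sym (lookup∘tabulate _ j)) ([]=⇒lookup j∈))
    of λ ()

  rank< : ∀ i → ∣ below i ∣ < p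
  rank< i = subst (∣ below i ∣ <_) (∣⊤∣≡n p)
    (p⊂q⇒∣p∣<∣q∣ (⊆⊤ , i , ∈⊤ , λ i∈ → ℕ.<-irrefl refl (∈-below⁻ {i} {i} i∈)))

  -- Counting the smaller keys compresses the keys to positions on a circle of `p` places without
  -- changing their order.
  rank : Fin p → Fin p
  rank i = fromℕ< (rank< i)

  rank-mono : ∀ {i j} → key i < key j → toℕ (rank i) < toℕ (rank j)
  rank-mono {i} {j} i<j
    rewrite toℕ-fromℕ< (rank< i) | toℕ-fromℕ< (rank< j) =
    p⊂q⇒∣p∣<∣q∣ ((λ {k} k∈ → ∈-below⁺ {j} {k} (ℕ.<-trans (∈-below⁻ {i} {k} k∈) i<j)) ,
      i , ∈-below⁺ {j} {i} i<j , λ i∈ → ℕ.<-irrefl refl (∈-below⁻ {i} {i} i∈))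

  rank-injective : Injective _≡_ _≡_ rank
  rank-injective {i} {j} eq with ℕ.<-cmp (key i) (key j)
  ... | tri< i<j _ _ = contradiction (cong toℕ eq) (ℕ.<⇒≢ (rank-mono i<j))
  ... | tri≈ _ i≡j _ = key-injective i≡j
  ... | tri> _ _ j<i = contradiction (cong toℕ (≡-sym eq)) (ℕ.<⇒≢ (rank-mono j<i))

  rank-reflects-< : ∀ {i j} → toℕ (rank i) < toℕ (rank j) → key i < key j
  rank-reflects-< {i} {j} lt with ℕ.<-cmp (key i) (key j)
  ... | tri< i<j _ _ = i<j
  ... | tri≈ _ i≡j _ = contradiction (cong (toℕ ∘ rank) (key-injective i≡j)) (ℕ.<⇒≢ lt)
  ... | tri> _ _ j<i = contradiction (rank-mono j<i) (ℕ.<-asym lt)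

  -- Closing the line to a circle turns arcs into chords with the same crossings. Each rotation of
  -- the cyclic order becomes the linear pattern after reversing or exchanging edges.
  drawn⇒outerplanar : ∀ {xs} {G : Graph p} → DrawnOn key xs G → Outerplanar G
  drawn⇒outerplanar {G = G} drawn = rank , rank-injective , uncrossed′
    where
    flip = Graph.sym G

    cross : ∀ {a b c d} → toℕ (rank a) < toℕ (rank c) → toℕ (rank c) < toℕ (rank b) →
      toℕ (rank b) < toℕ (rank d) → Adj G a b → Adj G c d → ⊥
    cross ac cb bd =
      DrawnOn.uncrossed drawn (rank-reflects-< ac) (rank-reflects-< cb) (rank-reflects-< bd)

    uncrossed′ : ∀ a b c d → Adj G a b → Adj G c d → CycOrd (rank a) (rank c) (rank b) (rank d) → ⊥
    uncrossed′ a b c d e f (inj₁ (ac , cb , bd))               = cross ac cb bd e f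
    uncrossed′ a b c d e f (inj₂ (inj₁ (cb , bd , da)))        = cross cb bd da f (flip e)
    uncrossed′ a b c d e f (inj₂ (inj₂ (inj₁ (bd , da , ac)))) = cross bd da ac (flip e) (flip f)
    uncrossed′ a b c d e f (inj₂ (inj₂ (inj₂ (da , ac , cb)))) = cross da ac cb (flip f) e

-- Injective keys and assembly of the theorem

module _ (c : Fin p → ℕ) where

  -- The index is added so that repeated members of the family receive distinct keys.
  keyOf : Fin p → ℕ
  keyOf i = c i * p + toℕ i

  -- The index is less than `p`, so it cannot make up for a step in `c`, which weighs `p`.
  keyOf-≤ : ∀ {i j} → keyOf i ≤ keyOf j → c i ≤ c j
  keyOf-≤ {i} {j} le = ℕ.≮⇒≥ λ cj<ci → ℕ.<⇒≱
    (ℕ.<-≤-trans (ℕ.+-monoʳ-< (c j * p) (toℕ<n j))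
      (ℕ.≤-trans (ℕ.≤-reflexive (ℕ.+-comm (c j * p) p))
        (ℕ.≤-trans (ℕ.*-monoˡ-≤ p cj<ci) (ℕ.m≤m+n (c i * p) (toℕ i)))))
    le

  keyOf-injective : Injective _≡_ _≡_ keyOf
  keyOf-injective {i} {j} eq = toℕ-injective (ℕ.+-cancelˡ-≡ (c i * p) _ _
    (≡-trans eq (cong (λ m → m * p + toℕ j) (≡-sym ci≡cj))))
    where
    ci≡cj : c i ≡ c j
    ci≡cj = ℕ.≤-antisym (keyOf-≤ (ℕ.≤-reflexive eq)) (keyOf-≤ (ℕ.≤-reflexive (≡-sym eq)))

theorem9 : (n p q : ℕ) → 3 ≤ n → (ℋ : Family n p) (𝒦 : Family n q) →
    StrongAxaxFree ℋ 𝒦 →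
    Σ (Graph p) λ G → IsIntersectionSupport ℋ 𝒦 G × Outerplanar G
theorem9 n p q _ ℋ 𝒦 strong =
  proj₁ support ,
  (λ k u v → proj₂ (proj₂ support) k (everyone u) (everyone v)) ,
  drawn⇒outerplanar key key-injective (proj₁ (proj₂ support))
  where
  key : Fin p → ℕ
  key = keyOf (code ∘ ℋ)

  key-injective : Injective _≡_ _≡_ key
  key-injective = keyOf-injective (code ∘ ℋ)

  S : Fin q → Fin p → Set
  S k i = Meets (ℋ i) (𝒦 k)

  S? : ∀ k i → Dec (S k i)
  S? k i = any? λ x → (x ∈? ℋ i) ×-dec (x ∈? 𝒦 k)

  abab : AbabFree key S
  abab k l a≺b b≺c c≺d Ska ¬Sla Slb ¬Skb Skc ¬Slc Sld _ =
    no-alternation strong k l (le a≺b) (le b≺c) (le c≺d) Ska ¬Sla Slb ¬Skb Skc ¬Slc Sld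
    where
    -- Repeated members have different keys but equal codes, hence the weak inequality.
    le : ∀ {i j} → key i < key j → code (ℋ i) ≤ code (ℋ j)
    le i<j = keyOf-≤ (code ∘ ℋ) (ℕ.<⇒≤ i<j)

  vertices : List (Fin p)
  vertices = sort key key-injective (allFin p)

  everyone : ∀ i → i ∈ vertices
  everyone i = ∈-sort key key-injective (∈-allFin i)

  support : Σ (Graph p) λ G → DrawnOn key vertices G × SupportedOn S vertices G
  support = drawSupport key S S? abab (length vertices) vertices ℕ.≤-refl
    (sort-sorted key key-injective (allFin p))
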